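{- Consider the following program on states $(x,y)\in\mathbb{Z}^2$. Initially $(x,y)$ is an arbitrary element of $\mathbb{Z}^2$ supplied by the user. While $x>0$, the simultaneous assignment $(x,y)=(x+y,\,y-1)$ is executed (the right-hand side uses the old values). Then every run of this program terminates, i.e., every computation of it is finite.
   Context: A program is a tuple $(S,I,R)$ where $S$ is a set of states, $I\subseteq S$ is the set of possible initial states, and $R\subseteq S\times S$ is the set of pairs $(s,t)$ such that $s$ satisfies the condition of the while loop and one iteration of the loop body takes $s$ to $t$. A computation (run) is a finite or infinite sequence of states $s_1,s_2,\ldots$ with $s_1\in I$, with $R(s_i,s_{i+1})$ for all consecutive terms, and such that if the sequence is finite with last state $s$ then there is no $t$ with $R(s,t)$. Here $S=I=\mathbb{Z}^2$. -}

module Defs where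

open import Data.Integer using (ℤ; 0ℤ; 1ℤ; _+_; _-_; _>_)
open import Data.Maybe using (Maybe; just; nothing)
open import Data.Nat using (ℕ; zero; suc)
open import Data.Product using (_×_; _,_; ∃-syntax)
open import Level using (0ℓ)
open import Relation.Binary using (Rel)
open import Relation.Binary.PropositionalEquality using (_≡_)
open import Relation.Nullary using (¬_)
open import Relation.Unary using (Pred; U)

record Program : Set₁ where
  field
    State   : Set
    Initial : Pred State 0ℓ
    Step    : Rel State 0ℓ

-- A finite or infinite sequence, indexed from 0: `at n ≡ nothing` means that
-- the sequence has at most n terms.  Not splitting the type into a finite and
-- an infinite summand keeps `Finite` from being decided by the representation.
record Sequence (A : Set) : Set where
  field
    at     : ℕ → Maybe A
    closed : ∀ n → at n ≡ nothing → at (suc n) ≡ nothing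

open Sequence public

Finite : {A : Set} → Sequence A → Set
Finite σ = ∃[ n ] at σ n ≡ nothing

record IsComputation (P : Program) (σ : Sequence (Program.State P)) : Set where
  open Program P
  field
    starts   : ∃[ s ] (at σ zero ≡ just s × Initial s)
    steps    : ∀ n s t → at σ n ≡ just s → at σ (suc n) ≡ just t → Step s t
    maximal  : ∀ n s → at σ n ≡ just s → at σ (suc n) ≡ nothing →
               ¬ (∃[ t ] Step s t)

Terminates : Program → Set
Terminates P = ∀ (σ : Sequence (Program.State P)) → IsComputation P σ → Finite σ

program : Program
program = record
  { State   = ℤ × ℤ
  ; Initial = U
  ; Step    = λ (x , y) t → x > 0ℤ × t ≡ (x + y , y - 1ℤ)
  }

{-# OPTIONS --safe #-}

-- Every state is accessible for the converse of the step relation.  While y ≥ 0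
-- the loop decreases y; once y < 0 it stays negative, so x strictly decreases at
-- every iteration until the guard x > 0 fails.

module Submission where

open import Data.Integer using (+_; -[1+_]; _≤_; ∣_∣; -≤-; -≤+)
open import Data.Integer.Properties using (+-mono-≤; ≤-refl; <⇒≱)
open import Data.Maybe using (just; nothing)
open import Data.Nat using (zero; suc; z≤n)
open import Data.Product using (_,_)
open import Function using (flip)
open import Induction.WellFounded using (Acc; acc; WellFounded)
open import Relation.Binary.PropositionalEquality using (_≡_; refl)
open import Relation.Nullary using (contradiction)

open import Defs

module _ {P : Program} where
  open Program P

  -- Induction on accessibility, walking along `σ`: either the term after position `n` is missing,
  -- which ends the sequence, or it is a `Step` successor of `s`.
  accessible⇒finite : ∀ {σ} → IsComputation P σ → ∀ {s} → Acc (flip Step) s →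
                      ∀ n → at σ n ≡ just s → Finite σ
  accessible⇒finite {σ} c {s} (acc rs) n eq with at σ (suc n) in eq′
  ... | nothing = suc n , eq′
  ... | just t  = accessible⇒finite c (rs (IsComputation.steps c n s t eq eq′)) (suc n) eq′

  wellFounded⇒terminates : WellFounded (flip Step) → Terminates P
  wellFounded⇒terminates wf σ c with IsComputation.starts c
  ... | s , eq , _ = accessible⇒finite c (wf s) zero eq

open Program program

i≤+∣i∣ : ∀ i → i ≤ + ∣ i ∣
i≤+∣i∣ (+ n)    = ≤-refl
i≤+∣i∣ -[1+ n ] = -≤+

-- Induction on the bound `k` rather than on `x`, which may drop by more than one at once; `m`
-- varies along the way.
accessible-negative : ∀ k x m → x ≤ + k → Acc (flip Step) (x , -[1+ m ])
accessible-negative zero    x m x≤0 = acc λ { (x>0 , refl) → contradiction x≤0 (<⇒≱ x>0) }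
accessible-negative (suc k) x m x≤1+k = acc λ { (_ , refl) →
  -- The added `y` is at most -1, and `+ suc k` plus -1 computes to `+ k`.
  accessible-negative k _ _ (+-mono-≤ x≤1+k (-≤- {m} {zero} z≤n)) }

accessible-nonNegative : ∀ n x → Acc (flip Step) (x , + n)
-- From `y` = 0 the next `y` is -1; the absolute value of the new `x` serves as the bound.
accessible-nonNegative zero    x = acc λ { (_ , refl) → accessible-negative _ _ _ (i≤+∣i∣ _) }
accessible-nonNegative (suc n) x = acc λ { (_ , refl) → accessible-nonNegative n _ }

step-wellFounded : WellFounded (flip Step)
step-wellFounded (x , + n)      = accessible-nonNegative n x
step-wellFounded (x , -[1+ m ]) = accessible-negative _ x m (i≤+∣i∣ x)

theorem11p1 : Terminates program
theorem11p1 = wellFounded⇒terminates step-wellFounded
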